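{- Let $P$ be a poset on $[n]=\{1,\dots,n\}$ whose labeling is natural (the identity permutation $e$ is a linear extension), and let $x_1,\dots,x_n$ be strictly positive reals. Let $M$ be the transition matrix of the promotion graph of $P$. Define, for $\pi\in\mathcal{L}(P)$, $$w(\pi)=\prod_{i=1}^{n}\frac{x_1+\cdots+x_i}{x_{\pi_1}+\cdots+x_{\pi_i}}.$$ Then $w$ is the stationary state of the promotion graph Markov chain normalized by $w(e)=1$, i.e. $\sum_{\pi\in\mathcal{L}(P)}M(\pi',\pi)\,w(\pi)=0$ for every $\pi'\in\mathcal{L}(P)$.
   Context: Linear extensions: $\mathcal{L}(P)=\{\pi\in S_n : i\prec j \text{ in } P \Rightarrow \pi^{ -1}_i<\pi^{ -1}_j\}$, written in one-line notation $\pi=\pi_1\cdots\pi_n$ (so $i\prec j$ means $i$ appears before $j$). For $1\le i<n$, the operator $\tau_i$ acts on the right on $\mathcal{L}(P)$: $\pi\tau_i$ is obtained from $\pi$ by swapping $\pi_i$ and $\pi_{i+1}$ if they are incomparable in $P$, and $\pi\tau_i=\pi$ otherwise. Operators compose as right actions: $\pi(\sigma\tau)=(\pi\sigma)\tau$. The extended promotion operators are $\partial_j=\tau_j\tau_{j+1}\cdots\tau_{n-1}$ for $1\le j\le n$ ($\partial_n$ is the identity). Promotion graph: vertex set $\mathcal{L}(P)$, and for each $\pi\in\mathcal{L}(P)$ and $j\in[n]$ a directed edge $\pi\to\pi\partial_j$ of weight $x_{\pi_j}$. Transition matrix $M$ (rows and columns indexed by $\mathcal{L}(P)$): for $\pi'\neq\pi$,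 $M(\pi',\pi)$ is the sum of the weights of edges $\pi\to\pi'$; $M(\pi,\pi)$ is minus the sum of weights of all edges $\pi\to\pi'$ with $\pi'\ne\pi$ (loops are not counted). -}

module Defs where

open import Algebra.Apartness.Bundles using (HeytingCommutativeRing; HeytingField)
open import Algebra.Bundles using (CommutativeRing)
open import Algebra.Definitions using (Invertible)
import Algebra.Properties.Monoid.Sum as MonoidSum
open import Data.Bool.Base using (if_then_else_)
open import Data.Fin.Base using (Fin; inject₁; inject≤; suc; toℕ; zero; _<_)
open import Data.Fin.Permutation using (Permutation′; id; insert; transpose; _∘ₚ_; _⟨$⟩ʳ_; _⟨$⟩ˡ_) renaming (_≈_ to _≈ₚ_)
open import Data.Fin.Properties using (all?; toℕ<n; _<?_; _≟_)
open import Data.List.Base using (List; [_]; allFin; concatMap; drop; filter; foldl; foldr; map)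
open import Data.Nat.Base using (ℕ; zero; suc; pred)
open import Data.Product.Base using (_×_; _,_; proj₁; proj₂)
open import Data.Sum.Base using (_⊎_)
open import Data.Vec.Functional using (Vector)
open import Level using (Level; _⊔_) renaming (suc to lsuc)
open import Relation.Binary.Core using (Rel)
open import Relation.Binary.Definitions using (Decidable)
open import Relation.Binary.PropositionalEquality.Core using (_≡_)
open import Relation.Binary.Structures using (IsStrictPartialOrder; IsDecPartialOrder)
import Relation.Binary.Construct.NonStrictToStrict as ToStrict
open import Relation.Nullary.Decidable using (Dec; does; ¬?; _×-dec_; _→-dec_)
open import Relation.Nullary.Negation using (¬_)

-- Stands in for ℝ.  The order need not be decidable, and x # y amounts to
-- x < y or y < x, so classical ℝ, the constructive Cauchy and Dedekind reals
-- and ℚ are all models.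
record OrderedField c ℓ₁ ℓ₂ : Set (lsuc (c ⊔ ℓ₁ ⊔ ℓ₂)) where
  infix 4 _<ᶠ_
  field
    heytingField : HeytingField c ℓ₁ ℓ₂

  open HeytingField heytingField public
  open HeytingCommutativeRing heytingCommutativeRing public using (commutativeRing)

  field
    _<ᶠ_                 : Rel Carrier ℓ₂
    isStrictPartialOrder : IsStrictPartialOrder _≈_ _<ᶠ_
    <⇒#                  : ∀ {x y} → x <ᶠ y → x # y
    #⇒<⊎>                : ∀ {x y} → x # y → x <ᶠ y ⊎ y <ᶠ x
    +-monoʳ-<            : ∀ z {x y} → x <ᶠ y → z + x <ᶠ z + y
    *-pos                : ∀ {x y} → 0# <ᶠ x → 0# <ᶠ y → 0# <ᶠ x * y

module FieldOps {c ℓ₁ ℓ₂ : Level} (F : OrderedField c ℓ₁ ℓ₂) where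
  open OrderedField F hiding (zero)
  open CommutativeRing commutativeRing using (+-monoid; *-monoid)
  open import Algebra.Apartness.Properties.HeytingCommutativeRing heytingCommutativeRing using (x-0≈x)
  open MonoidSum +-monoid public using (sum)
  open MonoidSum *-monoid public using () renaming (sum to product)

  Positive : Carrier → Set ℓ₂
  Positive x = 0# <ᶠ x

  positive⇒invertible : ∀ {x} → Positive x → Invertible _≈_ 1# _*_ x
  positive⇒invertible {x} x>0 = x⁻¹ , trans (*-congˡ (sym (x-0≈x x))) invˡ , trans (*-congʳ (sym (x-0≈x x))) invʳ
    where
    inv  = #⇒invertible (#-sym (<⇒# x>0))
    x⁻¹  = proj₁ inv
    invˡ = proj₁ (proj₂ inv)
    invʳ = proj₂ (proj₂ inv)

  divide : Carrier → (y : Carrier) → Positive y → Carrier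
  divide x y y>0 = x * proj₁ (positive⇒invertible y>0)

  +-positive : ∀ {x y} → Positive x → Positive y → Positive (x + y)
  +-positive {x} {y} x>0 y>0 =
    IsStrictPartialOrder.trans isStrictPartialOrder x>0
      (IsStrictPartialOrder.<-respˡ-≈ isStrictPartialOrder (+-identityʳ x) (+-monoʳ-< x y>0))

  sum-positive : ∀ {m} (y : Vector Carrier (suc m)) → (∀ i → Positive (y i)) → Positive (sum y)
  sum-positive {zero}  y y>0 =
    IsStrictPartialOrder.<-respʳ-≈ isStrictPartialOrder (sym (+-identityʳ (y zero))) (y>0 zero)
  sum-positive {suc m} y y>0 =
    +-positive (y>0 zero) (sum-positive (λ i → y (suc i)) (λ i → y>0 (suc i)))

  -- y₀ + ⋯ + yᵢ, inclusive of the last index.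
  partialSum : ∀ {n} → Vector Carrier n → Fin n → Carrier
  partialSum y i = sum {suc (toℕ i)} (λ k → y (inject≤ k (toℕ<n i)))

  partialSum-positive : ∀ {n} (y : Vector Carrier n) → (∀ i → Positive (y i)) →
                        ∀ i → Positive (partialSum y i)
  partialSum-positive y y>0 i = sum-positive _ (λ k → y>0 (inject≤ k (toℕ<n i)))

  sumOver : ∀ {a} {A : Set a} → List A → (A → Carrier) → Carrier
  sumOver xs f = foldr _+_ 0# (map f xs)

_≟ₚ_ : ∀ {n} → Decidable (_≈ₚ_ {n} {n})
π ≟ₚ ρ = all? (λ i → (π ⟨$⟩ʳ i) ≟ (ρ ⟨$⟩ʳ i))

-- Each element of Sₙ exactly once up to _≈ₚ_: choose the image of the first
-- position, then a permutation for the remaining positions and values.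
permutations : ∀ n → List (Permutation′ n)
permutations zero    = [ id ]
permutations (suc n) = concatMap (λ j → map (insert zero j) (permutations n)) (allFin (suc n))

-- The two positions exchanged by the i-th adjacent transposition; there are
-- n - 1 of these, indexed from zero.
left right : ∀ {n} → Fin (pred n) → Fin n
left  {suc n} i = inject₁ i
right {suc n} i = suc i

-- The ground set {1,…,n} is Fin n, and the one-line notation π₁⋯πₙ is
-- π ⟨$⟩ʳ_ read from index zero; a position in the inverse is π ⟨$⟩ˡ_.
module Promotion {n : ℕ} {ℓ : Level} {_≼_ : Rel (Fin n) ℓ}
                 (isPoset : IsDecPartialOrder _≡_ _≼_) where

  open IsDecPartialOrder isPoset using (_≤?_)

  infix 4 _≺_
  _≺_ : Rel (Fin n) ℓ
  _≺_ = ToStrict._<_ _≡_ _≼_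

  IsLinearExtension : Permutation′ n → Set ℓ
  IsLinearExtension π = ∀ i j → i ≺ j → (π ⟨$⟩ˡ i) < (π ⟨$⟩ˡ j)

  isLinearExtension? : ∀ π → Dec (IsLinearExtension π)
  isLinearExtension? π = all? λ i → all? λ j →
    ToStrict.<-decidable _≡_ _≼_ _≟_ _≤?_ i j →-dec ((π ⟨$⟩ˡ i) <? (π ⟨$⟩ˡ j))

  linearExtensions : List (Permutation′ n)
  linearExtensions = filter isLinearExtension? (permutations n)

  Incomparable : Rel (Fin n) ℓ
  Incomparable a b = ¬ (a ≼ b) × ¬ (b ≼ a)

  incomparable? : Decidable Incomparable
  incomparable? a b = ¬? (a ≤? b) ×-dec ¬? (b ≤? a)

  -- The operators act on the right, so π τᵢ and π ∂ⱼ are τ π i and ∂ π j.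
  -- They are defined by the same rule on all of Sₙ, and preserve the set of
  -- linear extensions.  Precomposition (_∘ₚ_ is diagrammatic) exchanges the
  -- entries of π by position.
  τ : Permutation′ n → Fin (pred n) → Permutation′ n
  τ π i = if does (incomparable? (π ⟨$⟩ʳ left i) (π ⟨$⟩ʳ right i))
          then transpose (left i) (right i) ∘ₚ π
          else π

  -- π τⱼ τⱼ₊₁ ⋯ τₙ₋₁, with τⱼ applied first.
  ∂ : Permutation′ n → Fin n → Permutation′ n
  ∂ π j = foldl τ π (drop (toℕ j) (allFin (pred n)))

  module Chain {c ℓ₁ ℓ₂ : Level} (F : OrderedField c ℓ₁ ℓ₂)
               (x : Vector (OrderedField.Carrier F) n) where
    open OrderedField F using (Carrier; 0#; -_)
    open FieldOps F

    -- M π′ π is the entry in row π′ and column π.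
    M : Permutation′ n → Permutation′ n → Carrier
    M π′ π = if does (π′ ≟ₚ π)
             then - sum (λ j → if does (∂ π j ≟ₚ π) then 0# else x (π ⟨$⟩ʳ j))
             else sum (λ j → if does (∂ π j ≟ₚ π′) then x (π ⟨$⟩ʳ j) else 0#)

    w : (∀ i → Positive (x i)) → Permutation′ n → Carrier
    w x>0 π = product λ i →
      divide (partialSum x i)
             (partialSum (λ k → x (π ⟨$⟩ʳ k)) i)
             (partialSum-positive _ (λ k → x>0 (π ⟨$⟩ʳ k)) i)

{-# OPTIONS --safe #-}
module Submission where

-- Writing M = (moves, loops included) - (total weight) on the diagonal, it must
-- be shown that the flow into π′ is (x₁ + ⋯ + xₙ) w(π′).  Each ∂ⱼ is a bijection
-- of the linear extensions, so the edges into π′ come from ρⱼ = π′ τₙ₋₁ ⋯ τⱼ, one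
-- for each j.  With Sₖ(ρ) the sum of the first k weights along ρ, the edge from
-- ρⱼ carries (Sⱼ(ρⱼ) - Sⱼ₋₁(ρⱼ)) w(ρⱼ).  Since ρⱼ = ρⱼ₊₁ τⱼ and τⱼ can only alter
-- the j-th factor of w, whose denominator is Sⱼ, we have
-- Sⱼ(ρⱼ) w(ρⱼ) = Sⱼ(ρⱼ₊₁) w(ρⱼ₊₁), and the flow telescopes.

open import Defs
open import Algebra.Bundles using (CommutativeRing)
import Algebra.Properties.AbelianGroup as AbelianGroupProperties
import Algebra.Properties.CommutativeMonoid.Sum as CommutativeMonoidSum
import Algebra.Properties.CommutativeSemigroup as CommutativeSemigroupProperties
import Algebra.Properties.Semiring.Sum as SemiringSum
open import Data.Bool.Base using (Bool; true; false; if_then_else_)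
open import Data.Fin.Base using (Fin; zero; suc; toℕ; inject≤; punchIn; _<_)
open import Data.Fin.Permutation using (Permutation; Permutation′; id; insert; insert-punchIn; insert-remove; remove; transpose; inverseˡ; inverseʳ; _∘ₚ_; _⟨$⟩ʳ_; _⟨$⟩ˡ_) renaming (_≈_ to _≈ₚ_)
import Data.Fin.Permutation.Components as PC
open import Data.Fin.Properties using (toℕ-injective; toℕ-inject₁; toℕ-fromℕ; toℕ<n; punchIn-injective; punchInᵢ≢i; suc-injective; _≟_)
open import Data.Fin.Relation.Unary.Top using (view; ‵fromℕ; ‵inject₁)
open import Data.List.Base using (List; []; _∷_; _++_; allFin; concatMap; drop; filter; foldl; foldr; map; tabulate)
open import Data.List.Properties using (drop-all; length-tabulate)
open import Data.Nat.Base as ℕ using (ℕ; zero; suc; pred; z≤n; s≤s; s≤s⁻¹)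
import Data.Nat.Properties as ℕ
open import Data.Product.Base using (∃; _×_; _,_; proj₁; proj₂)
open import Data.Sum.Base using (_⊎_; inj₁; inj₂)
open import Data.Vec.Functional using (Vector; removeAt; tail)
open import Function.Base using (_∘_; flip)
open import Function.Bundles using (mk⇔)
open import Level using (Level)
open import Relation.Binary.Core using (Rel)
open import Relation.Binary.PropositionalEquality as ≡ using (_≡_; _≢_)
import Relation.Binary.Reasoning.Setoid as SetoidReasoning
open import Relation.Binary.Structures using (IsDecPartialOrder)
open import Relation.Nullary.Decidable using (Dec; yes; no; does; dec-true; dec-false; does-⇔)
open import Relation.Nullary.Negation using (¬_; contradiction)
open import Relation.Unary using (Pred; Decidable)

-- Permutations up to pointwise equality

≈ₚ-sym : ∀ {m n} {π ρ : Permutation m n} → π ≈ₚ ρ → ρ ≈ₚ π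
≈ₚ-sym π≈ρ i = ≡.sym (π≈ρ i)

≈ₚ-trans : ∀ {m n} {π ρ σ : Permutation m n} → π ≈ₚ ρ → ρ ≈ₚ σ → π ≈ₚ σ
≈ₚ-trans π≈ρ ρ≈σ i = ≡.trans (π≈ρ i) (ρ≈σ i)

-- `_≈ₚ_` compares forward maps only, while linear extensions are defined through inverses. The
-- inverse laws carry the agreement across.
≈ₚ⇒≈ˡ : ∀ {m n} {π ρ : Permutation m n} → π ≈ₚ ρ → ∀ j → π ⟨$⟩ˡ j ≡ ρ ⟨$⟩ˡ j
≈ₚ⇒≈ˡ {π = π} {ρ} π≈ρ j =
  ≡.trans (≡.cong (π ⟨$⟩ˡ_) (≡.sym (≡.trans (π≈ρ (ρ ⟨$⟩ˡ j)) (inverseʳ ρ)))) (inverseˡ π)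

insert-here : ∀ {m n} i j (π : Permutation m n) → insert i j π ⟨$⟩ʳ i ≡ j
insert-here i j π with i ≟ i
... | yes _  = ≡.refl
... | no i≢i = contradiction ≡.refl i≢i

insert-cong⁻ : ∀ {m n} i j {π ρ : Permutation m n} → insert i j π ≈ₚ insert i j ρ → π ≈ₚ ρ
insert-cong⁻ i j {π} {ρ} eq k = punchIn-injective j _ _
  (≡.trans (≡.sym (insert-punchIn i j π k)) (≡.trans (eq _) (insert-punchIn i j ρ k)))

insert-cong : ∀ {m n} i j {π ρ : Permutation m n} → π ≈ₚ ρ → insert i j π ≈ₚ insert i j ρ
insert-cong i j π≈ρ k with i ≟ k
... | yes _ = ≡.refl
... | no _  = ≡.cong (punchIn j) (π≈ρ _)

-- Transpositions, and the effect of adjacent ones on the order of positions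

module _ {n : ℕ} where

  transpose-matchˡ : (i j : Fin n) → transpose i j ⟨$⟩ʳ i ≡ j
  transpose-matchˡ i j rewrite dec-true (i ≟ i) ≡.refl = ≡.refl

  transpose-matchʳ : (i j : Fin n) → transpose i j ⟨$⟩ʳ j ≡ i
  transpose-matchʳ i j with j ≟ i
  ... | yes j≡i = j≡i
  ... | no _ rewrite dec-true (j ≟ j) ≡.refl = ≡.refl

  transpose-mismatch : {i j k : Fin n} → k ≢ i → k ≢ j → transpose i j ⟨$⟩ʳ k ≡ k
  transpose-mismatch {i} {j} {k} k≢i k≢j
    rewrite dec-false (k ≟ i) k≢i | dec-false (k ≟ j) k≢j = ≡.refl

  transpose-involutive : (i j k : Fin n) → transpose i j ⟨$⟩ʳ (transpose i j ⟨$⟩ʳ k) ≡ k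
  transpose-involutive i j k = go (k ≟ i) (k ≟ j)
    where
    go : Dec (k ≡ i) → Dec (k ≡ j) → transpose i j ⟨$⟩ʳ (transpose i j ⟨$⟩ʳ k) ≡ k
    go (yes ≡.refl) _            = ≡.trans (≡.cong (PC.transpose i j) (transpose-matchˡ i j)) (transpose-matchʳ i j)
    go (no _)       (yes ≡.refl) = ≡.trans (≡.cong (PC.transpose i j) (transpose-matchʳ i j)) (transpose-matchˡ i j)
    go (no k≢i)     (no k≢j)     = ≡.trans (≡.cong (PC.transpose i j) (transpose-mismatch k≢i k≢j)) (transpose-mismatch k≢i k≢j)

toℕ-right : ∀ {n} (i : Fin (pred n)) → toℕ (right {n} i) ≡ suc (toℕ (left {n} i))
toℕ-right {suc n} i = ≡.cong suc (≡.sym (toℕ-inject₁ i))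

-- Separates the positions that have an operator τⱼ from the last one, where ∂ⱼ is the identity. The
-- index is recorded through `toℕ` as well, because j and i live in different `Fin` types.
leftOrLast : ∀ {n} (j : Fin n) → (∃ λ i → j ≡ left i × toℕ j ≡ toℕ i) ⊎ pred n ℕ.≤ toℕ j
leftOrLast {suc n} j with view j
... | ‵fromℕ     = inj₂ (ℕ.≤-reflexive (≡.sym (toℕ-fromℕ n)))
... | ‵inject₁ i = inj₁ (i , ≡.refl , toℕ-inject₁ i)

-- No position lies strictly between two adjacent ones, so exchanging them reverses the order of
-- that one pair only. The arguments come as `right i`, `left i` because this is the inverse
-- direction of `transpose (left i) (right i)`, the one that acts on the positions of labels.
transpose-adjacent-< : ∀ {n} (i : Fin (pred n)) {p q : Fin n} → p < q →
                       ¬ (p ≡ left i × q ≡ right i) →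
                       transpose (right i) (left i) ⟨$⟩ʳ p < transpose (right i) (left i) ⟨$⟩ʳ q
transpose-adjacent-< {n} i {p} {q} p<q p,q≢ = go (p ≟ left i) (p ≟ right i) (q ≟ left i) (q ≟ right i)
  where
  l = left {n} i
  r = right {n} i

  l<r : l < r
  l<r = ℕ.≤-reflexive (≡.sym (toℕ-right i))

  to< : ∀ {p′ q′} → transpose r l ⟨$⟩ʳ p ≡ p′ → transpose r l ⟨$⟩ʳ q ≡ q′ → p′ < q′ →
        transpose r l ⟨$⟩ʳ p < transpose r l ⟨$⟩ʳ q
  to< ≡.refl ≡.refl p′<q′ = p′<q′

  go : Dec (p ≡ l) → Dec (p ≡ r) → Dec (q ≡ l) → Dec (q ≡ r) →
       transpose r l ⟨$⟩ʳ p < transpose r l ⟨$⟩ʳ q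
  go (yes ≡.refl) _ (yes ≡.refl) _ = contradiction p<q (ℕ.<-irrefl ≡.refl)
  go (yes p≡l) _ (no _) (yes q≡r) = contradiction (p≡l , q≡r) p,q≢
  go (yes ≡.refl) _ (no q≢l) (no q≢r) =
    to< (transpose-matchʳ r l) (transpose-mismatch q≢r q≢l)
        (ℕ.≤∧≢⇒< (≡.subst (ℕ._≤ toℕ q) (≡.sym (toℕ-right i)) p<q) (q≢r ∘ ≡.sym ∘ toℕ-injective))
  go (no _) (yes ≡.refl) (yes ≡.refl) _ = contradiction (ℕ.<-trans p<q l<r) (ℕ.<-irrefl ≡.refl)
  go (no _) (yes ≡.refl) (no _) (yes ≡.refl) = contradiction p<q (ℕ.<-irrefl ≡.refl)
  go (no _) (yes ≡.refl) (no q≢l) (no q≢r) =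
    to< (transpose-matchˡ r l) (transpose-mismatch q≢r q≢l) (ℕ.<-trans l<r p<q)
  go (no p≢l) (no p≢r) (yes ≡.refl) _ =
    to< (transpose-mismatch p≢r p≢l) (transpose-matchʳ r l) (ℕ.<-trans p<q l<r)
  go (no p≢l) (no p≢r) (no _) (yes ≡.refl) =
    to< (transpose-mismatch p≢r p≢l) (transpose-matchˡ r l)
        -- Below `right i` means at most `left i`, and equality with `left i` is excluded.
        (ℕ.≤∧≢⇒< (s≤s⁻¹ (≡.subst (toℕ p ℕ.<_) (toℕ-right i) p<q)) (p≢l ∘ toℕ-injective))
  go (no p≢l) (no p≢r) (no q≢l) (no q≢r) =
    to< (transpose-mismatch p≢r p≢l) (transpose-mismatch q≢r q≢l) p<q

-- Exposes τⱼ at the head of the list of operators that make up ∂ⱼ.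
drop-tabulate : ∀ {a} {A : Set a} {n} (f : Fin n → A) i →
                drop (toℕ i) (tabulate f) ≡ f i ∷ drop (suc (toℕ i)) (tabulate f)
drop-tabulate f zero    = ≡.refl
drop-tabulate f (suc i) = drop-tabulate (f ∘ suc) i

-- The operators τ and ∂ on linear extensions, and the inverse of ∂

module PromotionProperties {n : ℕ} {ℓ : Level} {_≼_ : Rel (Fin n) ℓ}
                           (isPoset : IsDecPartialOrder _≡_ _≼_) where
  open Promotion isPoset

  module _ (π : Permutation′ n) (i : Fin (pred n)) where
    private
      incomparable = incomparable? (π ⟨$⟩ʳ left i) (π ⟨$⟩ʳ right i)

    τ-incomparable : Incomparable (π ⟨$⟩ʳ left i) (π ⟨$⟩ʳ right i) →
                     τ π i ≡ transpose (left i) (right i) ∘ₚ π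
    τ-incomparable inc = ≡.cong (if_then _ else π) (dec-true incomparable inc)

    τ-comparable : ¬ Incomparable (π ⟨$⟩ʳ left i) (π ⟨$⟩ʳ right i) → τ π i ≡ π
    τ-comparable ¬inc = ≡.cong (if_then transpose (left i) (right i) ∘ₚ π else π) (dec-false incomparable ¬inc)

    τ-elim : ∀ {p} (P : Permutation′ n → Set p) →
             (Incomparable (π ⟨$⟩ʳ left i) (π ⟨$⟩ʳ right i) → P (transpose (left i) (right i) ∘ₚ π)) →
             P π → P (τ π i)
    τ-elim P swapped fixed = go incomparable
      where
      go : Dec (Incomparable (π ⟨$⟩ʳ left i) (π ⟨$⟩ʳ right i)) → P (τ π i)
      go (yes inc) = ≡.subst P (≡.sym (τ-incomparable inc)) (swapped inc)
      go (no ¬inc) = ≡.subst P (≡.sym (τ-comparable ¬inc)) fixed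

  τ-cong : ∀ {π ρ} i → π ≈ₚ ρ → τ π i ≈ₚ τ ρ i
  τ-cong {π} {ρ} i π≈ρ k with incomparable? (π ⟨$⟩ʳ left i) (π ⟨$⟩ʳ right i)
  ... | yes inc = ≡.trans (≡.cong (_⟨$⟩ʳ k) (τ-incomparable π i inc))
                  (≡.trans (π≈ρ _) (≡.cong (_⟨$⟩ʳ k) (≡.sym (τ-incomparable ρ i (≡.subst₂ Incomparable (π≈ρ _) (π≈ρ _) inc)))))
  ... | no ¬inc = ≡.trans (≡.cong (_⟨$⟩ʳ k) (τ-comparable π i ¬inc))
                  (≡.trans (π≈ρ k) (≡.cong (_⟨$⟩ʳ k) (≡.sym (τ-comparable ρ i (¬inc ∘ ≡.subst₂ Incomparable (≡.sym (π≈ρ _)) (≡.sym (π≈ρ _)))))))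

  -- Incomparability is symmetric, so a pair that has been exchanged is exchanged back.
  τ-involutive : ∀ π i → τ (τ π i) i ≈ₚ π
  τ-involutive π i = go (incomparable? (π ⟨$⟩ʳ left i) (π ⟨$⟩ʳ right i))
    where
    t = transpose (left {n} i) (right i)

    inc-swap : Incomparable (π ⟨$⟩ʳ left i) (π ⟨$⟩ʳ right i) →
               Incomparable ((t ∘ₚ π) ⟨$⟩ʳ left i) ((t ∘ₚ π) ⟨$⟩ʳ right i)
    inc-swap (l⋠r , r⋠l) =
      ≡.subst₂ (λ p q → Incomparable (π ⟨$⟩ʳ p) (π ⟨$⟩ʳ q))
        (≡.sym (transpose-matchˡ (left i) (right i))) (≡.sym (transpose-matchʳ (left i) (right i))) (r⋠l , l⋠r)

    go : Dec (Incomparable (π ⟨$⟩ʳ left i) (π ⟨$⟩ʳ right i)) → τ (τ π i) i ≈ₚ π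
    go (no ¬inc) k = ≡.cong (_⟨$⟩ʳ k) (≡.trans (≡.cong (λ σ → τ σ i) (τ-comparable π i ¬inc)) (τ-comparable π i ¬inc))
    go (yes inc) k =
      ≡.trans (≡.cong (_⟨$⟩ʳ k) (≡.trans (≡.cong (λ σ → τ σ i) (τ-incomparable π i inc))
                                         (τ-incomparable (t ∘ₚ π) i (inc-swap inc))))
              (≡.cong (π ⟨$⟩ʳ_) (transpose-involutive (left i) (right i) k))

  -- Only the entries at `left i` and `right i` change their relative order. If a ≺ b occupied these
  -- positions, they would be comparable and τ would not exchange them.
  τ-isLinearExtension : ∀ {π} i → IsLinearExtension π → IsLinearExtension (τ π i)
  τ-isLinearExtension {π} i π∈L = τ-elim π i IsLinearExtension swapped π∈L
    where
    πʳ : ∀ {c p} → π ⟨$⟩ˡ c ≡ p → c ≡ π ⟨$⟩ʳ p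
    πʳ eq = ≡.trans (≡.sym (inverseʳ π)) (≡.cong (π ⟨$⟩ʳ_) eq)

    swapped : Incomparable (π ⟨$⟩ʳ left i) (π ⟨$⟩ʳ right i) →
              IsLinearExtension (transpose (left i) (right i) ∘ₚ π)
    swapped (l⋠r , _) a b a≺b = transpose-adjacent-< i (π∈L a b a≺b) λ (pa≡l , pb≡r) →
      l⋠r (≡.subst₂ _≼_ (πʳ pa≡l) (πʳ pb≡r) (proj₁ a≺b))

  isLinearExtension-resp-≈ₚ : ∀ {π ρ} → π ≈ₚ ρ → IsLinearExtension π → IsLinearExtension ρ
  isLinearExtension-resp-≈ₚ {π} {ρ} π≈ρ π∈L a b a≺b =
    ≡.subst₂ _<_ (≈ₚ⇒≈ˡ {π = π} {ρ} π≈ρ a) (≈ₚ⇒≈ˡ {π = π} {ρ} π≈ρ b) (π∈L a b a≺b)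

  foldl-τ-cong : ∀ is {π ρ} → π ≈ₚ ρ → foldl τ π is ≈ₚ foldl τ ρ is
  foldl-τ-cong []       π≈ρ = π≈ρ
  foldl-τ-cong (i ∷ is) {π} {ρ} π≈ρ = foldl-τ-cong is (τ-cong {π} {ρ} i π≈ρ)

  foldr-τ-cong : ∀ is {π ρ} → π ≈ₚ ρ → foldr (flip τ) π is ≈ₚ foldr (flip τ) ρ is
  foldr-τ-cong []       π≈ρ = π≈ρ
  foldr-τ-cong (i ∷ is) {π} {ρ} π≈ρ =
    τ-cong {foldr (flip τ) π is} {foldr (flip τ) ρ is} i (foldr-τ-cong is {π} {ρ} π≈ρ)

  -- `foldl` applies the head of the list first and `foldr` applies it last, so the involutions
  -- cancel in pairs from the inside out.
  foldr∘foldl-τ : ∀ is π → foldr (flip τ) (foldl τ π is) is ≈ₚ π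
  foldr∘foldl-τ []       π k = ≡.refl
  foldr∘foldl-τ (i ∷ is) π k =
    ≡.trans (τ-cong {foldr (flip τ) (foldl τ (τ π i) is) is} {τ π i} i (foldr∘foldl-τ is (τ π i)) k)
            (τ-involutive π i k)

  foldl∘foldr-τ : ∀ is π → foldl τ (foldr (flip τ) π is) is ≈ₚ π
  foldl∘foldr-τ []       π k = ≡.refl
  foldl∘foldr-τ (i ∷ is) π k =
    ≡.trans (foldl-τ-cong is (τ-involutive (foldr (flip τ) π is) i) k) (foldl∘foldr-τ is π k)

  foldr-τ-isLinearExtension : ∀ is {π} → IsLinearExtension π → IsLinearExtension (foldr (flip τ) π is)
  foldr-τ-isLinearExtension []       π∈L = π∈L
  foldr-τ-isLinearExtension (i ∷ is) {π} π∈L =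
    τ-isLinearExtension {foldr (flip τ) π is} i (foldr-τ-isLinearExtension is {π} π∈L)

  -- With indices from zero, π τₙ₋₂ ⋯ τⱼ₊₁ τⱼ; it is π itself once j ≥ n - 1.
  ∂⁻¹ : Permutation′ n → ℕ → Permutation′ n
  ∂⁻¹ π j = foldr (flip τ) π (drop j (allFin (pred n)))

  -- With its converse below, this determines the source of the edge into ρ with index j, up to
  -- `_≈ₚ_`. A sum over π restricted by `∂ π j ≈ₚ ρ` thus reduces to one term.
  ∂⁻¹∘∂ : ∀ {π ρ} j → ∂ π j ≈ₚ ρ → π ≈ₚ ∂⁻¹ ρ (toℕ j)
  ∂⁻¹∘∂ {π} {ρ} j ∂π≈ρ k =
    ≡.trans (≡.sym (foldr∘foldl-τ is π k)) (foldr-τ-cong is {∂ π j} {ρ} ∂π≈ρ k)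
    where is = drop (toℕ j) (allFin (pred n))

  ∂∘∂⁻¹ : ∀ {π ρ} j → π ≈ₚ ∂⁻¹ ρ (toℕ j) → ∂ π j ≈ₚ ρ
  ∂∘∂⁻¹ {π} {ρ} j π≈ k =
    ≡.trans (foldl-τ-cong is {π} {∂⁻¹ ρ (toℕ j)} π≈ k) (foldl∘foldr-τ is ρ k)
    where is = drop (toℕ j) (allFin (pred n))

  ∂⁻¹-isLinearExtension : ∀ {π} j → IsLinearExtension π → IsLinearExtension (∂⁻¹ π j)
  ∂⁻¹-isLinearExtension {π} j = foldr-τ-isLinearExtension (drop j (allFin (pred n))) {π}

  ∂⁻¹-step : ∀ π i → ∂⁻¹ π (toℕ i) ≡ τ (∂⁻¹ π (suc (toℕ i))) i
  ∂⁻¹-step π i = ≡.cong (foldr (flip τ) π) (drop-tabulate (λ k → k) i)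

  ∂⁻¹-end : ∀ π {j} → pred n ℕ.≤ j → ∂⁻¹ π j ≡ π
  ∂⁻¹-end π {j} n-1≤j = ≡.cong (foldr (flip τ) π) (drop-all j (allFin (pred n))
    (≡.subst (ℕ._≤ j) (≡.sym (length-tabulate {n = pred n} (λ k → k))) n-1≤j))

-- Field arithmetic, finite sums and products, prefix sums

module FieldProperties {c ℓ₁ ℓ₂ : Level} (F : OrderedField c ℓ₁ ℓ₂) where
  open OrderedField F using (commutativeRing)
  open CommutativeRing commutativeRing hiding (zero)
  open FieldOps F using (sum; product; Positive; positive⇒invertible; divide; partialSum; sumOver)
  open AbelianGroupProperties +-abelianGroup using (⁻¹-∙-comm)
  open CommutativeSemigroupProperties *-commutativeSemigroup using (x∙yz≈y∙xz)
  open CommutativeSemigroupProperties +-commutativeSemigroup using () renaming (x∙yz≈y∙xz to x+[y+z]≈y+[x+z])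
  open SemiringSum semiring using (sum-cong-≋; sum-remove; sum-replicate-zero; ∑-distrib-+)
  open CommutativeMonoidSum *-commutativeMonoid using () renaming (sum-remove to product-remove; sum-cong-≋ to product-cong)
  open SetoidReasoning setoid

  -- Serves the diagonal of M: y is the weight of the loops, z that of the other edges, x the total.
  y+z≈x⇒y-x≈-z : ∀ {x y z} → y + z ≈ x → y - x ≈ - z
  y+z≈x⇒y-x≈-z {x} {y} {z} y+z≈x = begin
    y - x            ≈⟨ +-congˡ (-‿cong y+z≈x) ⟨
    y - (y + z)      ≈⟨ +-congˡ (⁻¹-∙-comm y z) ⟨
    y + (- y + - z)  ≈⟨ +-assoc y (- y) (- z) ⟨
    (y - y) + - z    ≈⟨ +-congʳ (-‿inverseʳ y) ⟩
    0# + - z         ≈⟨ +-identityˡ (- z) ⟩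
    - z              ∎

  -- The inverse used by `divide` comes from a positivity proof. Uniqueness of inverses makes the
  -- quotient independent of that proof and compatible with `_≈_`.
  inverse-cong : ∀ {a b a⁻¹ b⁻¹} → a ≈ b → a * a⁻¹ ≈ 1# → b⁻¹ * b ≈ 1# → a⁻¹ ≈ b⁻¹
  inverse-cong {a} {b} {a⁻¹} {b⁻¹} a≈b aa⁻¹≈1 b⁻¹b≈1 = begin
    a⁻¹              ≈⟨ *-identityˡ a⁻¹ ⟨
    1# * a⁻¹         ≈⟨ *-congʳ b⁻¹b≈1 ⟨
    (b⁻¹ * b) * a⁻¹  ≈⟨ *-assoc b⁻¹ b a⁻¹ ⟩
    b⁻¹ * (b * a⁻¹)  ≈⟨ *-congˡ (*-congʳ a≈b) ⟨
    b⁻¹ * (a * a⁻¹)  ≈⟨ *-congˡ aa⁻¹≈1 ⟩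
    b⁻¹ * 1#         ≈⟨ *-identityʳ b⁻¹ ⟩
    b⁻¹              ∎

  divide-congʳ : ∀ {u a b} {a>0 : Positive a} {b>0 : Positive b} → a ≈ b → divide u a a>0 ≈ divide u b b>0
  divide-congʳ {a>0 = a>0} {b>0} a≈b = *-congˡ (inverse-cong a≈b
    (proj₂ (proj₂ (positive⇒invertible a>0))) (proj₁ (proj₂ (positive⇒invertible b>0))))

  divide-self : ∀ {a} {a>0 : Positive a} → divide a a a>0 ≈ 1#
  divide-self {a>0 = a>0} = proj₂ (proj₂ (positive⇒invertible a>0))

  *-divide-cancel : ∀ {u a} (a>0 : Positive a) → a * divide u a a>0 ≈ u
  *-divide-cancel {u} {a} a>0 = begin
    a * divide u a a>0  ≈⟨ x∙yz≈y∙xz a u _ ⟩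
    u * divide a a a>0  ≈⟨ *-congˡ (divide-self {a>0 = a>0}) ⟩
    u * 1#              ≈⟨ *-identityʳ u ⟩
    u                   ∎

  sum-zero : ∀ {n} {f : Vector Carrier n} → (∀ i → f i ≈ 0#) → sum f ≈ 0#
  sum-zero {n} f≈0 = trans (sum-cong-≋ f≈0) (sum-replicate-zero n)

  product-one : ∀ {n} {f : Vector Carrier n} → (∀ i → f i ≈ 1#) → product f ≈ 1#
  product-one {zero}  f≈1 = refl
  product-one {suc n} f≈1 = trans (*-cong (f≈1 zero) (product-one (f≈1 ∘ suc))) (*-identityˡ 1#)

  sum-single : ∀ {n} {f : Vector Carrier n} {v} i → f i ≈ v → (∀ j → j ≢ i → f j ≈ 0#) → sum f ≈ v
  sum-single {suc n} {f} {v} i fi≈v f≈0 = begin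
    sum f                    ≈⟨ sum-remove {i = i} f ⟩
    f i + sum (removeAt f i) ≈⟨ +-cong fi≈v (sum-zero (λ j → f≈0 _ (punchInᵢ≢i i j))) ⟩
    v + 0#                   ≈⟨ +-identityʳ v ⟩
    v                        ∎

  *-product-cong : ∀ {n} {f g : Vector Carrier n} {a b} i → a * f i ≈ b * g i →
                   (∀ j → j ≢ i → f j ≈ g j) → a * product f ≈ b * product g
  *-product-cong {suc n} {f} {g} {a} {b} i eq f≈g = begin
    a * product f                        ≈⟨ *-congˡ (product-remove {i = i} f) ⟩
    a * (f i * product (removeAt f i))   ≈⟨ *-assoc a (f i) _ ⟨
    (a * f i) * product (removeAt f i)   ≈⟨ *-cong eq (product-cong (λ j → f≈g _ (punchInᵢ≢i i j))) ⟩
    (b * g i) * product (removeAt g i)   ≈⟨ *-assoc b (g i) _ ⟩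
    b * (g i * product (removeAt g i))   ≈⟨ *-congˡ (product-remove {i = i} g) ⟨
    b * product g                        ∎

  -- Stated additively, so that no difference of consecutive values has to be formed. The induction
  -- shifts g by one.
  telescope : ∀ {n} (f : Vector Carrier n) (g : ℕ → Carrier) →
              (∀ j → f j + g (toℕ j) ≈ g (suc (toℕ j))) → sum f + g 0 ≈ g n
  telescope {zero}  f g step = +-identityˡ (g 0)
  telescope {suc n} f g step = begin
    (f zero + sum (tail f)) + g 0  ≈⟨ +-congʳ (+-comm (f zero) _) ⟩
    (sum (tail f) + f zero) + g 0  ≈⟨ +-assoc _ (f zero) (g 0) ⟩
    sum (tail f) + (f zero + g 0)  ≈⟨ +-congˡ (step zero) ⟩
    sum (tail f) + g 1             ≈⟨ telescope (tail f) (g ∘ suc) (step ∘ suc) ⟩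
    g (suc n)                      ∎

  -- The argument counts the entries summed, whereas `partialSum` takes the last index. This admits
  -- the empty prefix, where the telescoping starts; past the end the sum stays constant.
  prefixSum : ∀ {n} → Vector Carrier n → ℕ → Carrier
  prefixSum         y zero    = 0#
  prefixSum {zero}  y (suc k) = 0#
  prefixSum {suc n} y (suc k) = y zero + prefixSum (tail y) k

  sum-inject≤ : ∀ {n} (y : Vector Carrier n) {k} (k≤n : k ℕ.≤ n) → sum (λ i → y (inject≤ i k≤n)) ≈ prefixSum y k
  sum-inject≤ y {zero}  z≤n       = refl
  sum-inject≤ y {suc k} (s≤s k≤n) = +-congˡ (sum-inject≤ (tail y) k≤n)

  partialSum≈prefixSum : ∀ {n} (y : Vector Carrier n) i → partialSum y i ≈ prefixSum y (suc (toℕ i))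
  partialSum≈prefixSum y i = sum-inject≤ y (toℕ<n i)

  prefixSum-all : ∀ {n} (y : Vector Carrier n) → prefixSum y n ≈ sum y
  prefixSum-all {zero}  y = refl
  prefixSum-all {suc n} y = +-congˡ (prefixSum-all (tail y))

  prefixSum-suc : ∀ {n} (y : Vector Carrier n) i → y i + prefixSum y (toℕ i) ≈ prefixSum y (suc (toℕ i))
  prefixSum-suc y zero    = refl
  prefixSum-suc y (suc i) = begin
    y (suc i) + (y zero + prefixSum (tail y) (toℕ i))  ≈⟨ x+[y+z]≈y+[x+z] _ _ _ ⟩
    y zero + (y (suc i) + prefixSum (tail y) (toℕ i))  ≈⟨ +-congˡ (prefixSum-suc (tail y) i) ⟩
    y zero + prefixSum (tail y) (suc (toℕ i))          ∎

  prefixSum-cong : ∀ {n} {y z : Vector Carrier n} k → (∀ i → y i ≈ z i) → prefixSum y k ≈ prefixSum z k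
  prefixSum-cong         zero    y≈z = refl
  prefixSum-cong {zero}  (suc k) y≈z = refl
  prefixSum-cong {suc n} (suc k) y≈z = +-cong (y≈z zero) (prefixSum-cong k (y≈z ∘ suc))

  -- A prefix contains both exchanged positions or neither, unless it ends between them. The
  -- excluded length is the one that ends at `left i`.
  prefixSum-swap : ∀ {n} (i : Fin (pred n)) {y z : Vector Carrier n} →
                   y (left i) ≈ z (right i) → y (right i) ≈ z (left i) →
                   (∀ j → j ≢ left i → j ≢ right i → y j ≈ z j) →
                   ∀ k → k ≢ suc (toℕ (left {n} i)) → prefixSum y k ≈ prefixSum z k
  prefixSum-swap {suc (suc n)} i       yl yr y≈z zero          k≢ = refl
  prefixSum-swap {suc (suc n)} zero    yl yr y≈z (suc zero)    k≢ = contradiction ≡.refl k≢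
  prefixSum-swap {suc (suc n)} zero    {y} {z} yl yr y≈z (suc (suc k)) k≢ = begin
    y zero + (y (suc zero) + prefixSum (tail (tail y)) k)
      ≈⟨ +-cong yl (+-cong yr (prefixSum-cong k (λ j → y≈z (suc (suc j)) (λ ()) (λ ())))) ⟩
    z (suc zero) + (z zero + prefixSum (tail (tail z)) k)
      ≈⟨ x+[y+z]≈y+[x+z] _ _ _ ⟩
    z zero + (z (suc zero) + prefixSum (tail (tail z)) k)  ∎
  prefixSum-swap {suc (suc n)} (suc i) yl yr y≈z (suc k)       k≢ =
    +-cong (y≈z zero (λ ()) (λ ()))
      (prefixSum-swap i yl yr (λ j j≢l j≢r → y≈z (suc j) (j≢l ∘ suc-injective) (j≢r ∘ suc-injective)) k (k≢ ∘ ≡.cong suc))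

  -- Sums over lists and over all permutations

  module _ {a} {A : Set a} where

    sumOver-cong : ∀ (xs : List A) {f g : A → Carrier} → (∀ x → f x ≈ g x) → sumOver xs f ≈ sumOver xs g
    sumOver-cong []       f≈g = refl
    sumOver-cong (x ∷ xs) f≈g = +-cong (f≈g x) (sumOver-cong xs f≈g)

    sumOver-zero : ∀ (xs : List A) {f : A → Carrier} → (∀ x → f x ≈ 0#) → sumOver xs f ≈ 0#
    sumOver-zero []       f≈0 = refl
    sumOver-zero (x ∷ xs) f≈0 = trans (+-cong (f≈0 x) (sumOver-zero xs f≈0)) (+-identityˡ 0#)

    sumOver-++ : ∀ (xs ys : List A) (f : A → Carrier) → sumOver (xs ++ ys) f ≈ sumOver xs f + sumOver ys f
    sumOver-++ []       ys f = sym (+-identityˡ _)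
    sumOver-++ (x ∷ xs) ys f = trans (+-congˡ (sumOver-++ xs ys f)) (sym (+-assoc _ _ _))

    sumOver-+ : ∀ (xs : List A) (f g : A → Carrier) → sumOver xs (λ x → f x + g x) ≈ sumOver xs f + sumOver xs g
    sumOver-+ []       f g = sym (+-identityˡ 0#)
    sumOver-+ (x ∷ xs) f g = trans (+-congˡ (sumOver-+ xs f g)) (interchange _ _ _ _)
      where open CommutativeSemigroupProperties +-commutativeSemigroup using (interchange)

    sumOver-sum : ∀ (xs : List A) {n} (f : A → Vector Carrier n) →
                  sumOver xs (λ x → sum (f x)) ≈ sum (λ j → sumOver xs (λ x → f x j))
    sumOver-sum []       {n} f = sym (sum-zero {n} (λ _ → refl))
    sumOver-sum (x ∷ xs) f = trans (+-congˡ (sumOver-sum xs f)) (sym (∑-distrib-+ (f x) _))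

    sumOver-filter : ∀ {p} {P : Pred A p} (P? : Decidable P) xs (f : A → Carrier) →
                     sumOver (filter P? xs) f ≈ sumOver xs (λ x → if does (P? x) then f x else 0#)
    sumOver-filter P? []       f = refl
    sumOver-filter P? (x ∷ xs) f with does (P? x)
    ... | true  = +-congˡ (sumOver-filter P? xs f)
    ... | false = trans (sumOver-filter P? xs f) (sym (+-identityˡ _))

    sumOver-tabulate : ∀ {n} (xs : Fin n → A) (f : A → Carrier) → sumOver (tabulate xs) f ≈ sum (f ∘ xs)
    sumOver-tabulate {zero}  xs f = refl
    sumOver-tabulate {suc n} xs f = +-congˡ (sumOver-tabulate (xs ∘ suc) f)

  sumOver-map : ∀ {a b} {A : Set a} {B : Set b} (g : A → B) xs (f : B → Carrier) →
                sumOver (map g xs) f ≈ sumOver xs (f ∘ g)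
  sumOver-map g []       f = refl
  sumOver-map g (x ∷ xs) f = +-congˡ (sumOver-map g xs f)

  sumOver-concatMap : ∀ {a b} {A : Set a} {B : Set b} (g : A → List B) xs (f : B → Carrier) →
                      sumOver (concatMap g xs) f ≈ sumOver xs (λ x → sumOver (g x) f)
  sumOver-concatMap g []       f = refl
  sumOver-concatMap g (x ∷ xs) f =
    trans (sumOver-++ (g x) (concatMap g xs) f) (+-congˡ (sumOver-concatMap g xs f))

  -- The list is grouped by the image of the first position. Groups whose image differs from that of
  -- ρ vanish, and in the remaining one `insert` gives ρ exactly for the class of `remove zero ρ`,
  -- so induction applies. The value v is prescribed on the whole class because ρ itself need not be
  -- the listed representative.
  sumOver-permutations : ∀ {n} (f : Permutation′ n → Carrier) ρ {v} →
                         (∀ π → π ≈ₚ ρ → f π ≈ v) → (∀ π → ¬ (π ≈ₚ ρ) → f π ≈ 0#) →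
                         sumOver (permutations n) f ≈ v
  sumOver-permutations {zero}  f ρ at-ρ off-ρ = trans (+-identityʳ _) (at-ρ id (λ ()))
  sumOver-permutations {suc n} f ρ {v} at-ρ off-ρ = begin
    sumOver (permutations (suc n)) f
      ≈⟨ sumOver-concatMap (λ j → map (insert zero j) (permutations n)) (allFin (suc n)) f ⟩
    sumOver (allFin (suc n)) (λ j → sumOver (map (insert zero j) (permutations n)) f)
      ≈⟨ sumOver-tabulate {n = suc n} (λ j → j) _ ⟩
    sum (λ j → sumOver (map (insert zero j) (permutations n)) f)
      ≈⟨ sum-cong-≋ {suc n} (λ j → sumOver-map (insert zero j) (permutations n) f) ⟩
    sum (λ j → sumOver (permutations n) (f ∘ insert zero j))
      ≈⟨ sum-single (ρ ⟨$⟩ʳ zero)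
           (sumOver-permutations (f ∘ insert zero (ρ ⟨$⟩ʳ zero)) (remove zero ρ)
             (λ σ σ≈ → at-ρ (insert zero (ρ ⟨$⟩ʳ zero) σ) (insert≈ρ {σ} σ≈))
             (λ σ σ≉ → off-ρ (insert zero (ρ ⟨$⟩ʳ zero) σ) (σ≉ ∘ ≈remove {σ})))
           (λ j j≢ → sumOver-zero (permutations n) (λ σ → off-ρ (insert zero j σ) (λ eq → j≢ (≡.trans (≡.sym (insert-here zero j σ)) (eq zero))))) ⟩
    v ∎
    where
    insert≈ρ : ∀ {σ} → σ ≈ₚ remove zero ρ → insert zero (ρ ⟨$⟩ʳ zero) σ ≈ₚ ρ
    insert≈ρ {σ} σ≈ k = ≡.trans (insert-cong zero (ρ ⟨$⟩ʳ zero) {σ} {remove zero ρ} σ≈ k) (insert-remove zero ρ k)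

    ≈remove : ∀ {σ} → insert zero (ρ ⟨$⟩ʳ zero) σ ≈ₚ ρ → σ ≈ₚ remove zero ρ
    ≈remove {σ} eq = insert-cong⁻ zero (ρ ⟨$⟩ʳ zero) {σ} {remove zero ρ}
      (λ k → ≡.trans (eq k) (≡.sym (insert-remove zero ρ k)))

-- The weight w, the flow into a state, and stationarity

module ChainProperties {c ℓ₁ ℓ₂ ℓ : Level} (F : OrderedField c ℓ₁ ℓ₂)
                       {n : ℕ} {_≼_ : Rel (Fin n) ℓ} (isPoset : IsDecPartialOrder _≡_ _≼_)
                       (x : Vector (OrderedField.Carrier F) n)
                       (x>0 : ∀ i → FieldOps.Positive F (x i)) where
  open OrderedField F using (commutativeRing)
  open CommutativeRing commutativeRing hiding (zero)
  open FieldOps F using (sum; divide; partialSum; partialSum-positive; sumOver)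
  open FieldProperties F
  open Promotion isPoset
  open PromotionProperties isPoset
  open Chain F x
  open CommutativeMonoidSum *-commutativeMonoid using () renaming (sum-cong-≋ to product-cong)
  open SemiringSum semiring using (sum-cong-≋; ∑-distrib-+; *-distribʳ-sum)
  open SetoidReasoning setoid

  infixl 8 _·_
  _·_ : Permutation′ n → Vector Carrier n
  (π · k) = x (π ⟨$⟩ʳ k)

  W : Permutation′ n → Carrier
  W = w x>0

  w-id : W id ≈ 1#
  w-id = product-one (λ i → divide-self {a>0 = partialSum-positive x x>0 i})

  ·-cong : ∀ {π ρ} → π ≈ₚ ρ → ∀ k → π · k ≈ ρ · k
  ·-cong π≈ρ k = reflexive (≡.cong x (π≈ρ k))

  w-factor : Permutation′ n → Fin n → Carrier
  w-factor π i = divide (partialSum x i) (partialSum (π ·_) i) (partialSum-positive _ (λ k → x>0 (π ⟨$⟩ʳ k)) i)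

  -- The numerator does not involve the permutation, so only the denominators have to agree.
  w-factor-cong : ∀ π ρ i → prefixSum (π ·_) (suc (toℕ i)) ≈ prefixSum (ρ ·_) (suc (toℕ i)) →
                  w-factor π i ≈ w-factor ρ i
  w-factor-cong π ρ i eq = divide-congʳ
    (trans (partialSum≈prefixSum (π ·_) i) (trans eq (sym (partialSum≈prefixSum (ρ ·_) i))))

  w-cong : ∀ {π ρ} → π ≈ₚ ρ → W π ≈ W ρ
  w-cong {π} {ρ} π≈ρ = product-cong (λ i → w-factor-cong π ρ i (prefixSum-cong (suc (toℕ i)) (·-cong {π} {ρ} π≈ρ)))

  prefixSum*w-factor : ∀ π i → prefixSum (π ·_) (suc (toℕ i)) * w-factor π i ≈ partialSum x i
  prefixSum*w-factor π i = trans (*-congʳ (sym (partialSum≈prefixSum (π ·_) i)))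
                                 (*-divide-cancel (partialSum-positive _ (λ k → x>0 (π ⟨$⟩ʳ k)) i))

  -- Exchanging the entries at positions i and i + 1 changes a single factor of
  -- w, and multiplying by its denominator removes the dependence on π.
  prefixSum*w-τ : ∀ π i → let k = suc (toℕ (left {n} i)) in
                  prefixSum (τ π i ·_) k * W (τ π i) ≈ prefixSum (π ·_) k * W π
  prefixSum*w-τ π i = τ-elim π i (λ ρ → prefixSum (ρ ·_) k * W ρ ≈ prefixSum (π ·_) k * W π) (λ _ → swapped) refl
    where
    k = suc (toℕ (left {n} i))
    ρ = transpose (left i) (right i) ∘ₚ π

    swapped : prefixSum (ρ ·_) k * W ρ ≈ prefixSum (π ·_) k * W π
    swapped = *-product-cong (left i)
      (trans (prefixSum*w-factor ρ (left i)) (sym (prefixSum*w-factor π (left i))))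
      (λ j j≢l → w-factor-cong ρ π j (prefixSum-swap i
        (reflexive (≡.cong (π ·_) (transpose-matchˡ (left i) (right i))))
        (reflexive (≡.cong (π ·_) (transpose-matchʳ (left i) (right i))))
        (λ m m≢l m≢r → reflexive (≡.cong (π ·_) (transpose-mismatch m≢l m≢r)))
        (suc (toℕ j)) (j≢l ∘ toℕ-injective ∘ ℕ.suc-injective)))

  prefixSum*w-∂⁻¹ : ∀ π j → prefixSum (∂⁻¹ π (toℕ j) ·_) (suc (toℕ j)) * W (∂⁻¹ π (toℕ j)) ≈
                    prefixSum (∂⁻¹ π (suc (toℕ j)) ·_) (suc (toℕ j)) * W (∂⁻¹ π (suc (toℕ j)))
  prefixSum*w-∂⁻¹ π j with leftOrLast j
  -- At the last position no operator remains, and both permutations are π.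
  ... | inj₂ last rewrite ∂⁻¹-end π last | ∂⁻¹-end π (ℕ.m≤n⇒m≤1+n last) = refl
  -- Otherwise ρⱼ is ρⱼ₊₁ τⱼ, and the rule for a single τ applies at the prefix ending at `left i`.
  ... | inj₁ (i , ≡.refl , j≡i) = trans
    (reflexive (≡.cong (λ ρ → prefixSum (ρ ·_) (suc (toℕ j)) * W ρ)
      (≡.trans (≡.cong (∂⁻¹ π) j≡i) (≡.trans (∂⁻¹-step π i) (≡.cong (λ m → τ (∂⁻¹ π (suc m)) i) (≡.sym j≡i))))))
    (prefixSum*w-τ (∂⁻¹ π (suc (toℕ j))) i)

  -- The partial totals are `flow k`, that is Sₖ(ρₖ) w(ρₖ) with k counting entries. It is zero at 0,
  -- where the prefix is empty, and at n the prefix is everything and ρₙ is π.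
  incoming-flow : ∀ π → sum (λ j → ∂⁻¹ π (toℕ j) · j * W (∂⁻¹ π (toℕ j))) ≈ sum (π ·_) * W π
  incoming-flow π = begin
    sum (λ j → ∂⁻¹ π (toℕ j) · j * W (∂⁻¹ π (toℕ j)))
      ≈⟨ +-identityʳ _ ⟨
    sum (λ j → ∂⁻¹ π (toℕ j) · j * W (∂⁻¹ π (toℕ j))) + 0#
      ≈⟨ +-congˡ (zeroˡ _) ⟨
    sum (λ j → ∂⁻¹ π (toℕ j) · j * W (∂⁻¹ π (toℕ j))) + flow 0
      ≈⟨ telescope _ flow step ⟩
    flow n
      ≈⟨ *-congʳ (prefixSum-all (∂⁻¹ π n ·_)) ⟩
    sum (∂⁻¹ π n ·_) * W (∂⁻¹ π n)
      ≈⟨ reflexive (≡.cong (λ ρ → sum (ρ ·_) * W ρ) (∂⁻¹-end π {n} ℕ.pred[n]≤n)) ⟩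
    sum (π ·_) * W π ∎
    where
    flow : ℕ → Carrier
    flow k = prefixSum (∂⁻¹ π k ·_) k * W (∂⁻¹ π k)

    -- Both terms on the left carry the same w(ρⱼ), so the entry at j extends the prefix of ρⱼ
    -- first; only then is ρⱼ replaced by ρⱼ₊₁.
    step : ∀ j → ∂⁻¹ π (toℕ j) · j * W (∂⁻¹ π (toℕ j)) + flow (toℕ j) ≈ flow (suc (toℕ j))
    step j = trans (sym (distribʳ _ _ _))
             (trans (*-congʳ (prefixSum-suc (∂⁻¹ π (toℕ j) ·_) j)) (prefixSum*w-∂⁻¹ π j))

  -- Loops are added to the diagonal and subtracted again inside the total weight. The first summand
  -- then has the same form for all π, and each ∂ⱼ can be inverted in it without exceptions.
  M-expand : ∀ π′ π → M π′ π ≈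
             sum (λ j → if does (∂ π j ≟ₚ π′) then π · j else 0#) + (if does (π′ ≟ₚ π) then - sum (π ·_) else 0#)
  M-expand π′ π = go (π′ ≟ₚ π)
    where
    moves = sum (λ j → if does (∂ π j ≟ₚ π′) then π · j else 0#)
    -- In this sum loops count zero, so it is the weight of the edges that leave π. On the diagonal
    -- the loops are gathered by `moves`.
    loops = sum (λ j → if does (∂ π j ≟ₚ π) then 0# else π · j)

    if-+ : ∀ b (a : Carrier) → (if b then a else 0#) + (if b then 0# else a) ≈ a
    if-+ true  a = +-identityʳ a
    if-+ false a = +-identityˡ a

    split : π′ ≈ₚ π → moves + loops ≈ sum (π ·_)
    split π′≈π = trans (sym (∑-distrib-+ {n} _ _)) (sum-cong-≋ {n} (λ j →
      trans (+-congʳ (reflexive (≡.cong (if_then π · j else 0#)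
        (does-⇔ (mk⇔ (λ eq → ≈ₚ-trans {π = ∂ π j} {π′} {π} eq π′≈π)
                     (λ eq → ≈ₚ-trans {π = ∂ π j} {π} {π′} eq (≈ₚ-sym {π = π′} {π} π′≈π)))
                (∂ π j ≟ₚ π′) (∂ π j ≟ₚ π)))))
        (if-+ (does (∂ π j ≟ₚ π)) (π · j))))

    go : (d : Dec (π′ ≈ₚ π)) → (if does d then - loops else moves) ≈
                               moves + (if does d then - sum (π ·_) else 0#)
    go (yes π′≈π) = sym (y+z≈x⇒y-x≈-z (split π′≈π))
    go (no _)     = sym (+-identityʳ moves)

  -- Being a linear extension respects `_≈ₚ_`, so the filter keeps the listed representative of ρ.
  sumOver-linearExtensions : ∀ (f : Permutation′ n → Carrier) ρ {v} → IsLinearExtension ρ →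
                             (∀ π → π ≈ₚ ρ → f π ≈ v) → (∀ π → ¬ (π ≈ₚ ρ) → f π ≈ 0#) →
                             sumOver linearExtensions f ≈ v
  sumOver-linearExtensions f ρ ρ∈L at-ρ off-ρ =
    trans (sumOver-filter isLinearExtension? (permutations n) f)
      (sumOver-permutations _ ρ
        (λ π π≈ρ → trans
          (reflexive (≡.cong (if_then f π else 0#)
            (dec-true (isLinearExtension? π) (isLinearExtension-resp-≈ₚ {ρ} {π} (≈ₚ-sym {π = π} {ρ} π≈ρ) ρ∈L))))
          (at-ρ π π≈ρ))
        (λ π π≉ρ → if-zero (does (isLinearExtension? π)) (off-ρ π π≉ρ)))
    where
    if-zero : ∀ b {a : Carrier} → a ≈ 0# → (if b then a else 0#) ≈ 0#
    if-zero true  a≈0 = a≈0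
    if-zero false _   = refl

  -- Used twice: with P the condition that the edge of index j ends at π′, and with P equality to π′
  -- for the diagonal term.
  sumOver-if-* : ∀ {p} {P : Permutation′ n → Set p} (P? : ∀ π → Dec (P π)) ρ (f : Permutation′ n → Carrier) →
                 IsLinearExtension ρ → (∀ {π} → P π → π ≈ₚ ρ) → (∀ {π} → π ≈ₚ ρ → P π) →
                 (∀ {π} → π ≈ₚ ρ → f π ≈ f ρ) →
                 sumOver linearExtensions (λ π → (if does (P? π) then f π else 0#) * W π) ≈ f ρ * W ρ
  sumOver-if-* P? ρ f ρ∈L P⇒≈ ≈⇒P f-cong = sumOver-linearExtensions _ ρ ρ∈L
    (λ π π≈ρ → *-cong
      (trans (reflexive (≡.cong (if_then f π else 0#) (dec-true (P? π) (≈⇒P {π} π≈ρ)))) (f-cong {π} π≈ρ))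
      (w-cong {π} {ρ} π≈ρ))
    (λ π π≉ρ → trans
      (*-congʳ (reflexive (≡.cong (if_then f π else 0#) (dec-false (P? π) (π≉ρ ∘ P⇒≈ {π})))))
      (zeroˡ (W π)))

  stationary : ∀ π′ → IsLinearExtension π′ → sumOver linearExtensions (λ π → M π′ π * W π) ≈ 0#
  stationary π′ π′∈L = begin
    sumOver linearExtensions (λ π → M π′ π * W π)
      ≈⟨ sumOver-cong linearExtensions (λ π → trans (*-congʳ (M-expand π′ π))
           (trans (distribʳ _ _ _) (+-congʳ (*-distribʳ-sum {n} (W π) _)))) ⟩
    sumOver linearExtensions (λ π → sum (λ j → move j π * W π) + stay π * W π)
      ≈⟨ sumOver-+ linearExtensions _ _ ⟩
    sumOver linearExtensions (λ π → sum (λ j → move j π * W π)) + sumOver linearExtensions (λ π → stay π * W π)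
      -- Exchanging the sums puts j outside. For each j only the class of `∂⁻¹ π′ (toℕ j)` survives
      -- in the inner sum, and in the diagonal part only the class of π′.
      ≈⟨ +-cong
           (trans (sumOver-sum linearExtensions {n} (λ π j → move j π * W π)) (sum-cong-≋ {n} (λ j →
             sumOver-if-* (λ π → ∂ π j ≟ₚ π′) (∂⁻¹ π′ (toℕ j)) (_· j)
               (∂⁻¹-isLinearExtension {π′} (toℕ j) π′∈L)
               (λ {π} → ∂⁻¹∘∂ {π} {π′} j)
               (λ {π} → ∂∘∂⁻¹ {π} {π′} j)
               (λ {π} π≈ → ·-cong {π} {∂⁻¹ π′ (toℕ j)} π≈ j))))
           (sumOver-if-* (π′ ≟ₚ_) π′ (λ π → - sum (π ·_)) π′∈L
             (λ {π} → ≈ₚ-sym {π = π′} {π})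
             (λ {π} → ≈ₚ-sym {π = π} {π′})
             (λ {π} π≈ → -‿cong (sum-cong-≋ {n} (·-cong {π} {π′} π≈)))) ⟩
    sum (λ j → ∂⁻¹ π′ (toℕ j) · j * W (∂⁻¹ π′ (toℕ j))) + - sum (π′ ·_) * W π′
      ≈⟨ +-congʳ (incoming-flow π′) ⟩
    sum (π′ ·_) * W π′ + - sum (π′ ·_) * W π′
      ≈⟨ distribʳ (W π′) _ _ ⟨
    (sum (π′ ·_) - sum (π′ ·_)) * W π′
      ≈⟨ *-congʳ (-‿inverseʳ _) ⟩
    0# * W π′
      ≈⟨ zeroˡ _ ⟩
    0# ∎
    where
    move : Fin n → Permutation′ n → Carrier
    move j π = if does (∂ π j ≟ₚ π′) then π · j else 0#

    stay : Permutation′ n → Carrier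
    stay π = if does (π′ ≟ₚ π) then - sum (π ·_) else 0#

theorem4p5 : ∀ {c ℓ₁ ℓ₂ ℓ : Level} (F : OrderedField c ℓ₁ ℓ₂) →
    let open OrderedField F
        open FieldOps F
    in
    (n : ℕ) (_≼_ : Rel (Fin n) ℓ) (isPoset : IsDecPartialOrder _≡_ _≼_) →
    let open Promotion isPoset in
    IsLinearExtension id →
    (x : Vector Carrier n) (x>0 : ∀ i → Positive (x i)) →
    let open Chain F x in
    w x>0 id ≈ 1# ×
    (∀ (π′ : Permutation′ n) → IsLinearExtension π′ →
       sumOver linearExtensions (λ π → M π′ π * w x>0 π) ≈ 0#)
theorem4p5 F n _≼_ isPoset _ x x>0 = w-id , stationary
  where open ChainProperties F isPoset x x>0
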